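{- Let $F_0$ be a quantifier-free formula in conjunctive normal form whose atoms are polynomial inequalities with integer coefficients over integer-valued variables (a QF-NIA formula). Consider the following procedure $\mathrm{SolveMinModels}(F_0)$, which is parametrized by a family of cost functions and by an optimization oracle. (1) Choose a finite set $B$ of artificial bounds (constraints $V\ge L$ or $V\le U$ with $L,U\in\mathbb{Z}$ on variables $V$ of $F_0$) sufficient to linearize $F_0$, and let $F$ be the linearization of $F_0$ with artificial bounds $B$ (as defined in the context). (2) Repeat until a time limit is exceeded: call the oracle on $(F,B)$. The oracle either returns $\mathrm{Unsat}$, which it does only if $F$ is unsatisfiable over the integers, or returns a model $M$ of $F$ minimizing $\mathrm{cost}(M)$ among all models of $F$, where $\mathrm{cost}$ is the cost function associated with the current $F$ and $B$. If the oracle returns $\mathrm{Unsat}$, the procedure returns $\mathrm{Unsat}$. Otherwise, if $\mathrm{cost}(M)=0$, the procedure returns $\mathrm{Sat}$. Otherwise, choose a nonempty set $S$ of bounds of $B$ violated by $M$. Form $B'$ from $B$ by replacing each $V\ge L$ in $S$ with $V\ge M(V)$ and each $V\le U$ in $S$ with $V\le M(V)$. Add to $F$ the case-splitting clauses $V=K\rightarrow v_Q=Q[V:=K]$ for every value $K$ newly included in the domain of $V$ and every monomial $Q$ linearized using $V$. Set $B:=B'$. (3) If the time limit is exceeded, return $\mathrm{Unknown}$. Suppose that, at every iteration, the cost function used is admissible for the current linearization $F$ of $F_0$ with the current artificial bounds $B$. Then: (i) if $\mathrm{SolveMinModels}(F_0)$ returns $\mathrm{Sat}$, then $F_0$ is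 satisfiable over the integers; and (ii) if $\mathrm{SolveMinModels}(F_0)$ returns $\mathrm{Unsat}$, then $F_0$ is unsatisfiable over the integers.
   Context: Linearization. Let $F_0$ be a QF-NIA formula and let $B$ be a set of artificial bounds, i.e. constraints $V\ge L$ or $V\le U$ on variables of $F_0$. A linearization $F$ of $F_0$ with artificial bounds $B$ is a QF-LIA formula obtained as follows. While some non-linear monomial $Q$ occurs, pick a variable $V$ of $Q$ that has both a lower bound $l$ and an upper bound $u$ in $F_0\cup B$. Introduce a fresh integer variable $v_Q$ and replace every occurrence of $Q$ by $v_Q$. Add, for each integer $K$ with $l\le K\le u$, the case-splitting clause $V=K\rightarrow v_Q=Q[V:=K]$, where $Q[V:=K]$ is $Q$ with $V$ evaluated at $K$. If new non-linear monomials appear in these clauses, they are processed in the same way. The resulting formula $F$ consists of the clauses of $F_0$ with monomials replaced, together with all case-splitting clauses. It does not contain the bounds of $B$. A model of $F$ is an integer assignment to the original and fresh variables satisfying $F$; it need not satisfy $B$. Admissibility. A function $\mathrm{cost}$ on the models of $F$ is admissible if (1) $\mathrm{cost}(M)\ge 0$ for every model $M$ of $F$, and (2) whenever $\mathrm{cost}(M)=0$, the assignment $M$ (restricted to the variables of $F_0$) is a model of $F_0$. -}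

module Defs where

open import Level using (0ℓ; _⊔_) renaming (suc to lsuc)
open import Data.Bool using (if_then_else_)
open import Data.Unit.Polymorphic using (⊤)
open import Data.Fin using (Fin; zero; suc; _↑ˡ_; _↑ʳ_)
import Data.Fin.Properties as Fin
open import Data.Integer using (ℤ; 0ℤ; 1ℤ; _+_; _*_; _^_; _≤_; _<_; _≥_; _>_)
import Data.Integer.Properties as ℤ
open import Data.List using (List; []; _∷_; _++_; [_]; map; foldr; concatMap)
open import Data.List.Membership.Propositional using (_∈_)
open import Data.List.Relation.Binary.Subset.Propositional using (_⊆_)
open import Data.List.Relation.Unary.All using (All)
open import Data.List.Relation.Unary.Any using (Any; any?)
open import Data.Nat as ℕ using (ℕ)
import Data.Nat.Properties as ℕ
open import Data.Product using (∃-syntax; _×_; _,_; proj₂; map₂)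
open import Data.Sum using (_⊎_)
open import Data.Vec as Vec using (Vec; lookup; _[_]≔_)
import Data.Vec.Properties as Vec
open import Function using (_∘_; _⇔_)
open import Relation.Binary using (TotalOrder; DecidableEquality)
open import Relation.Binary.Construct.Closure.ReflexiveTransitive using (Star)
open import Relation.Binary.PropositionalEquality using (_≡_; _≢_; refl)
open import Relation.Nullary using (¬_; yes; no; ⌊_⌋)

-- A monomial is its vector of exponents.
Monomial : ℕ → Set
Monomial k = Vec ℕ k

-- A polynomial is a formal sum of terms (coefficient , monomial).
Polynomial : ℕ → Set
Polynomial k = List (ℤ × Monomial k)

data Comparison : Set where
  le lt ge gt : Comparison

record Atom (k : ℕ) : Set where
  constructor atom
  field
    lhs        : Polynomial k
    comparison : Comparison
    rhs        : Polynomial k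

data Literal (k : ℕ) : Set where
  pos neg : Atom k → Literal k

Clause : ℕ → Set
Clause k = List (Literal k)

CNF : ℕ → Set
CNF k = List (Clause k)

degree : ∀ {k} → Monomial k → ℕ
degree = Vec.sum

Nonlinear : ∀ {k} → Monomial k → Set
Nonlinear q = 2 ℕ.≤ degree q

oneᵐ : ∀ {k} → Monomial k
oneᵐ {k} = Vec.replicate k 0

varᵐ : ∀ {k} → Fin k → Monomial k
varᵐ i = oneᵐ [ i ]≔ 1

var : ∀ {k} → Fin k → Polynomial k
var i = [ (1ℤ , varᵐ i) ]

const : ∀ {k} → ℤ → Polynomial k
const c = [ (c , oneᵐ) ]

-- Q [ V := K ] is K ^ e times the rest of Q, e being the exponent of V in
-- Q; it is the zero polynomial, without any monomial, when K ^ e vanishes.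
_[_:=_] : ∀ {k} → Monomial k → Fin k → ℤ → Polynomial k
q [ v := K ] =
  if ⌊ c ℤ.≟ 0ℤ ⌋ then [] else [ (c , q [ v ]≔ 0) ]
  where c = K ^ lookup q v

Assignment : ℕ → Set
Assignment k = Vec ℤ k

⟦_⟧ᵐ : ∀ {k} → Monomial k → Assignment k → ℤ
⟦ q ⟧ᵐ M = Vec.foldr _ _*_ 1ℤ (Vec.zipWith _^_ M q)

⟦_⟧ : ∀ {k} → Polynomial k → Assignment k → ℤ
⟦ p ⟧ M = foldr (λ (c , q) s → c * ⟦ q ⟧ᵐ M + s) 0ℤ p

Compare : Comparison → ℤ → ℤ → Set
Compare le = _≤_
Compare lt = _<_
Compare ge = _≥_
Compare gt = _>_

Holdsᵃ : ∀ {k} → Assignment k → Atom k → Set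
Holdsᵃ M (atom p c q) = Compare c (⟦ p ⟧ M) (⟦ q ⟧ M)

Holdsˡ : ∀ {k} → Assignment k → Literal k → Set
Holdsˡ M (pos a) = Holdsᵃ M a
Holdsˡ M (neg a) = ¬ Holdsᵃ M a

infix 4 _⊨_
_⊨_ : ∀ {k} → Assignment k → CNF k → Set
M ⊨ F = All (Any (Holdsˡ M)) F

Satisfiable : ∀ {k} → CNF k → Set
Satisfiable F = ∃[ M ] M ⊨ F

data Bound (n : ℕ) : Set where
  _≥ᵇ_ _≤ᵇ_ : Fin n → ℤ → Bound n

_≟ᵇ_ : ∀ {n} → DecidableEquality (Bound n)
(V ≥ᵇ L) ≟ᵇ (W ≥ᵇ K) with V Fin.≟ W | L ℤ.≟ K
... | yes refl | yes refl = yes refl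
... | no V≢W   | _        = no λ { refl → V≢W refl }
... | _        | no L≢K   = no λ { refl → L≢K refl }
(V ≤ᵇ L) ≟ᵇ (W ≤ᵇ K) with V Fin.≟ W | L ℤ.≟ K
... | yes refl | yes refl = yes refl
... | no V≢W   | _        = no λ { refl → V≢W refl }
... | _        | no L≢K   = no λ { refl → L≢K refl }
(_ ≥ᵇ _) ≟ᵇ (_ ≤ᵇ _) = no λ ()
(_ ≤ᵇ _) ≟ᵇ (_ ≥ᵇ _) = no λ ()

boundVar : ∀ {n} → Bound n → Fin n
boundVar (V ≥ᵇ _) = V
boundVar (V ≤ᵇ _) = V

Allows : ∀ {n} → Bound n → ℤ → Set
Allows (_ ≥ᵇ L) K = K ≥ L
Allows (_ ≤ᵇ U) K = K ≤ U

boundClause : ∀ {n} → Bound n → Clause n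
boundClause (V ≥ᵇ L) = [ pos (atom (var V) ge (const L)) ]
boundClause (V ≤ᵇ U) = [ pos (atom (var V) le (const U)) ]

infix 4 _∈_∪_
_∈_∪_ : ∀ {n} → Bound n → CNF n → List (Bound n) → Set
b ∈ F₀ ∪ B = boundClause b ∈ F₀ ⊎ b ∈ B

-- The domain of V: the values allowed by every bound on V in F₀ ∪ B.
InDomain : ∀ {n} → CNF n → List (Bound n) → Fin n → ℤ → Set
InDomain F₀ B V K = ∀ b → b ∈ F₀ ∪ B → boundVar b ≡ V → Allows b K

-- A formula under linearization has m fresh and n original variables.  Its
-- variables are Fin (m + n), with the fresh ones first, so that a formula
-- without fresh variables is over Fin n, and a newly introduced variable is
-- always zero, the previous ones being shifted by suc.

-- The clause  V = K → v = P.
record SplitClause (k : ℕ) : Set where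
  constructor split
  field
    V : Fin k
    K : ℤ
    v : Fin k
    P : Polynomial k

record Formula (m n : ℕ) : Set where
  constructor formula
  field
    clauses : CNF (m ℕ.+ n)
    splits  : List (SplitClause (m ℕ.+ n))

open Formula public

HoldsSplit : ∀ {k} → Assignment k → SplitClause k → Set
HoldsSplit M (split V K v P) = lookup M V ≡ K → lookup M v ≡ ⟦ P ⟧ M

infix 4 _⊨ᶠ_
_⊨ᶠ_ : ∀ {m n} → Assignment (m ℕ.+ n) → Formula m n → Set
M ⊨ᶠ F = M ⊨ clauses F × All (HoldsSplit M) (splits F)

Satisfiableᶠ : ∀ {m n} → Formula m n → Set
Satisfiableᶠ F = ∃[ M ] M ⊨ᶠ F

-- The proof is irrelevant so that functions of a model depend on the
-- assignment only.
record Model {m n} (F : Formula m n) : Set where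
  constructor model
  field
    assignment : Assignment (m ℕ.+ n)
    .satisfies : assignment ⊨ᶠ F

open Model public

restrict : ∀ {m n} {F : Formula m n} → Model F → Assignment n
restrict {m} M = Vec.drop m (assignment M)

mapPolynomialsᶜ : ∀ {k l} → (Polynomial k → Polynomial l) → CNF k → CNF l
mapPolynomialsᶜ {k} {l} f = map (map literal)
  where
  atom′ : Atom k → Atom l
  atom′ (atom p c q) = atom (f p) c (f q)

  literal : Literal k → Literal l
  literal (pos a) = pos (atom′ a)
  literal (neg a) = neg (atom′ a)

polynomialsᶜ : ∀ {k} → CNF k → List (Polynomial k)
polynomialsᶜ {k} = concatMap (concatMap literal)
  where
  literal : Literal k → List (Polynomial k)
  literal (pos (atom p _ q)) = p ∷ q ∷ []
  literal (neg (atom p _ q)) = p ∷ q ∷ []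

monomials : ∀ {m n} → Formula m n → List (Monomial (m ℕ.+ n))
monomials F =
  concatMap (map proj₂) (polynomialsᶜ (clauses F) ++ map SplitClause.P (splits F))

LinearFormula : ∀ {m n} → Formula m n → Set
LinearFormula F = All (¬_ ∘ Nonlinear) (monomials F)

weakenᵖ : ∀ {k} → Polynomial k → Polynomial (ℕ.suc k)
weakenᵖ = map (map₂ (0 Vec.∷_))

weaken : ∀ {m n} → Formula m n → Formula (ℕ.suc m) n
weaken (formula cs ss) = formula
  (mapPolynomialsᶜ weakenᵖ cs)
  (map (λ (split V K v P) → split (suc V) K (suc v) (weakenᵖ P)) ss)

replaceᵖ : ∀ {k} → Monomial k → Fin k → Polynomial k → Polynomial k
replaceᵖ q v = map (map₂ λ q′ → if ⌊ Vec.≡-dec ℕ._≟_ q′ q ⌋ then varᵐ v else q′)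

replace : ∀ {m n} → Monomial (m ℕ.+ n) → Fin (m ℕ.+ n) → Formula m n → Formula m n
replace q v (formula cs ss) = formula
  (mapPolynomialsᶜ (replaceᵖ q v) cs)
  (map (λ (split V K w P) → split V K w (replaceᵖ q v P)) ss)

addSplits : ∀ {m n} → List (SplitClause (m ℕ.+ n)) → Formula m n → Formula m n
addSplits new (formula cs ss) = formula cs (ss ++ new)

-- The monomial Q has been linearized using the original variable V and is
-- represented by the fresh variable v.
record Entry (m n : ℕ) : Set where
  constructor entry
  field
    Q : Monomial (m ℕ.+ n)
    V : Fin n
    v : Fin m

weakenᵉ : ∀ {m n} → Entry m n → Entry (ℕ.suc m) n
weakenᵉ (entry Q V v) = entry (0 Vec.∷ Q) V (suc v)

-- V = K → v_Q = Q [ V := K ]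
splitClause : ∀ {m n} → Entry m n → ℤ → SplitClause (m ℕ.+ n)
splitClause {m} {n} (entry Q V v) K = split (m ↑ʳ V) K (v ↑ˡ n) (Q [ m ↑ʳ V := K ])

record State (n : ℕ) : Set where
  constructor state
  field
    {fresh} : ℕ
    current : Formula fresh n
    table   : List (Entry fresh n)

open State public

Enumerates : {A : Set} → List A → (A → Set) → Set
Enumerates xs P = ∀ x → x ∈ xs ⇔ P x

introduce : ∀ {m n} → Formula m n → List (Entry m n) →
            Monomial (m ℕ.+ n) → Fin n → List ℤ → State n
introduce {m} {n} F T Q V Ks = state
  (addSplits (map (splitClause e) Ks) (replace (Entry.Q e) zero (weaken F)))
  (e ∷ map weakenᵉ T)
  where
  e : Entry (ℕ.suc m) n
  e = entry (0 Vec.∷ Q) V zero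

-- Since a monomial that was already replaced may reappear in a case-splitting
-- clause added later, its existing variable may be used again.
data Step {n} (F₀ : CNF n) (B : List (Bound n)) : State n → State n → Set where
  new : ∀ {m} {F : Formula m n} {T Q V l u Ks} →
        Q ∈ monomials F → Nonlinear Q →
        lookup Q (m ↑ʳ V) ≢ 0 →
        (V ≥ᵇ l) ∈ F₀ ∪ B → (V ≤ᵇ u) ∈ F₀ ∪ B →
        Enumerates Ks (λ K → l ≤ K × K ≤ u) →
        Step F₀ B (state F T) (introduce F T Q V Ks)
  reuse : ∀ {m} {F : Formula m n} {T Q V v} →
          Q ∈ monomials F → Nonlinear Q → entry Q V v ∈ T →
          Step F₀ B (state F T) (state (replace Q (v ↑ˡ n) F) T)

Linearizes : ∀ {n} → CNF n → List (Bound n) → State n → State n → Set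
Linearizes F₀ B L₀ L = Star (Step F₀ B) L₀ L × LinearFormula (current L)

initial : ∀ {n} → CNF n → State n
initial F₀ = state {fresh = 0} (formula F₀ []) []

IsLinearization : ∀ {n} → CNF n → List (Bound n) → State n → Set
IsLinearization F₀ B L = Linearizes F₀ B (initial F₀) L

Violates : ∀ {n} → Assignment n → Bound n → Set
Violates M b = ¬ Allows b (lookup M (boundVar b))

relax : ∀ {n} → Assignment n → Bound n → Bound n
relax M (V ≥ᵇ _) = V ≥ᵇ lookup M V
relax M (V ≤ᵇ _) = V ≤ᵇ lookup M V

relaxAll : ∀ {n} → Assignment n → List (Bound n) → List (Bound n) → List (Bound n)
relaxAll M S = map λ b → if ⌊ any? (b ≟ᵇ_) S ⌋ then relax M b else b

NewSplit : ∀ {n} → CNF n → (B B′ : List (Bound n)) (L : State n) →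
           SplitClause (fresh L ℕ.+ n) → Set
NewSplit F₀ B B′ L s =
  ∃[ e ] ∃[ K ] e ∈ table L
    × InDomain F₀ B′ (Entry.V e) K × ¬ InDomain F₀ B (Entry.V e) K
    × s ≡ splitClause e K

-- The clauses added may contain non-linear monomials, which are then
-- linearized with the new bounds.
data Refine {n} (F₀ : CNF n) (L : State n) (B : List (Bound n)) (M : Assignment n) :
            State n → List (Bound n) → Set where
  refine : ∀ {S new L′} → let B′ = relaxAll M S B in
           S ≢ [] → S ⊆ B → All (Violates M) S →
           Enumerates new (NewSplit F₀ B B′ L) →
           Linearizes F₀ B′ (state (addSplits new (current L)) (table L)) L′ →
           Refine F₀ L B M L′ B′

data Result : Set where
  sat unsat unknown : Result

data Answer {m n} (F : Formula m n) : Set where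
  unsat : Answer F
  found : Model F → Answer F

-- Costs take values in an arbitrary totally ordered set with a
-- distinguished element 0#.
module Procedure {c ℓ₁ ℓ₂} (C : TotalOrder c ℓ₁ ℓ₂) (0# : TotalOrder.Carrier C) (n : ℕ) where

  private module C = TotalOrder C

  CostFamily : Set c
  CostFamily = ∀ {m} (F : Formula m n) → List (Bound n) → Model F → C.Carrier

  Admissible : ∀ {m} → CNF n → (F : Formula m n) → (Model F → C.Carrier) → Set (ℓ₁ ⊔ ℓ₂)
  Admissible F₀ F cost =
      (∀ M → 0# C.≤ cost M)
    × (∀ M → cost M C.≈ 0# → restrict M ⊨ F₀)

  -- The oracle is a relation between calls and answers: it need be neither
  -- deterministic nor total.
  record Oracle (cost : CostFamily) : Set (lsuc 0ℓ ⊔ ℓ₂) where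
    field
      Returns       : ∀ {m} (F : Formula m n) → List (Bound n) → Answer F → Set
      unsat-correct : ∀ {m} {F : Formula m n} {B} →
                      Returns F B unsat → ¬ Satisfiableᶠ F
      found-minimal : ∀ {m} {F : Formula m n} {B M} →
                      Returns F B (found M) → ∀ M′ → cost F B M C.≤ cost F B M′

  module _ (cost : CostFamily) (oracle : Oracle cost) (F₀ : CNF n) where

    open Oracle oracle

    -- Executions of the main loop; the time limit may be exceeded at the start
    -- of any iteration.
    data Loop (L : State n) (B : List (Bound n)) : Result → Set ℓ₁ where
      time-limit   : Loop L B unknown
      return-unsat : Returns (current L) B unsat → Loop L B unsat
      return-sat   : ∀ {M} → Returns (current L) B (found M) →
                     cost (current L) B M C.≈ 0# → Loop L B sat
      iterate      : ∀ {M L′ B′ r} → Returns (current L) B (found M) →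
                     ¬ (cost (current L) B M C.≈ 0#) →
                     Refine F₀ L B (restrict M) L′ B′ →
                     Loop L′ B′ r → Loop L B r

    data SolveMinModels : Result → Set ℓ₁ where
      start : ∀ {L r} B → IsLinearization F₀ B L → Loop L B r → SolveMinModels r

    LoopAdmissible : ∀ {L B r} → Loop L B r → Set (ℓ₁ ⊔ ℓ₂)
    LoopAdmissible time-limit = ⊤
    LoopAdmissible {L} {B} (return-unsat _) = Admissible F₀ (current L) (cost (current L) B)
    LoopAdmissible {L} {B} (return-sat _ _) = Admissible F₀ (current L) (cost (current L) B)
    LoopAdmissible {L} {B} (iterate _ _ _ run) =
      Admissible F₀ (current L) (cost (current L) B) × LoopAdmissible run

    AdmissibleThroughout : ∀ {r} → SolveMinModels r → Set (ℓ₁ ⊔ ℓ₂)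
    AdmissibleThroughout (start _ _ run) = LoopAdmissible run

{-# OPTIONS --safe #-}
module Submission where

-- Soundness of Sat is clause (2) of admissibility.  For Unsat, every model of
-- F₀ extends to a model of each formula F met during the execution, by giving
-- each fresh variable v_Q the value of the monomial Q.  Under such an
-- assignment replacing Q by v_Q changes no value, and a case-splitting clause
-- V = K → v_Q = Q [ V := K ] holds for every K whatsoever, so neither the
-- bounds B nor their relaxation matter.

open import Defs
open import Data.Fin using (Fin; zero; suc; _↑ˡ_; _↑ʳ_)
open import Data.Integer using (0ℤ; 1ℤ; _+_; _*_; _^_)
import Data.Integer.Properties as ℤ
open import Data.List using ([]; _∷_)
open import Data.List.Membership.Propositional using (_∈_)
open import Data.List.Relation.Unary.All as All using (All; []; _∷_)
import Data.List.Relation.Unary.All.Properties as All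
import Data.List.Relation.Unary.Any as Any
import Data.List.Relation.Unary.Any.Properties as Any
open import Data.Nat as ℕ using (ℕ)
open import Data.Product using (_×_; _,_; ∃-syntax)
open import Data.Vec as Vec using (lookup; _[_]≔_)
import Data.Vec.Properties as Vec
open import Function using (_∘_; Equivalence)
open import Relation.Binary using (TotalOrder)
open import Relation.Binary.Construct.Closure.ReflexiveTransitive using (Star; ε; _◅_)
open import Relation.Binary.PropositionalEquality using (_≡_; refl; sym; trans; cong; cong₂; subst₂; module ≡-Reasoning)
open import Relation.Nullary using (¬_; yes; no)

⟦oneᵐ⟧ : ∀ {k} (M : Assignment k) → ⟦ oneᵐ ⟧ᵐ M ≡ 1ℤ
⟦oneᵐ⟧ Vec.[]       = refl
-- `x ^ 0` computes to `1ℤ`, so a zero exponent at the head costs one use of the identity law; the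
-- same happens in later lemmas.
⟦oneᵐ⟧ (x Vec.∷ M) = trans (ℤ.*-identityˡ _) (⟦oneᵐ⟧ M)

⟦varᵐ⟧ : ∀ {k} (i : Fin k) (M : Assignment k) → ⟦ varᵐ i ⟧ᵐ M ≡ lookup M i
⟦varᵐ⟧ zero    (x Vec.∷ M) = begin
  x ^ 1 * ⟦ oneᵐ ⟧ᵐ M ≡⟨ cong₂ _*_ (ℤ.*-identityʳ x) (⟦oneᵐ⟧ M) ⟩
  x * 1ℤ              ≡⟨ ℤ.*-identityʳ x ⟩
  x                   ∎
  where open ≡-Reasoning
⟦varᵐ⟧ (suc i) (x Vec.∷ M) = trans (ℤ.*-identityˡ _) (⟦varᵐ⟧ i M)

-- Zeroing the exponent turns the `i`-th factor of the product into 1, and the power in front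
-- restores it. The recursion moves that power past the head factor.
⟦[]≔0⟧ᵐ : ∀ {k} (q : Monomial k) i (M : Assignment k) →
          lookup M i ^ lookup q i * ⟦ q [ i ]≔ 0 ⟧ᵐ M ≡ ⟦ q ⟧ᵐ M
⟦[]≔0⟧ᵐ (e Vec.∷ q) zero    (x Vec.∷ M) = cong (x ^ e *_) (ℤ.*-identityˡ _)
⟦[]≔0⟧ᵐ (e Vec.∷ q) (suc i) (x Vec.∷ M) = begin
  y * (x ^ e * z) ≡⟨ ℤ.*-assoc y (x ^ e) z ⟨
  y * x ^ e * z   ≡⟨ cong (_* z) (ℤ.*-comm y (x ^ e)) ⟩
  x ^ e * y * z   ≡⟨ ℤ.*-assoc (x ^ e) y z ⟩
  x ^ e * (y * z) ≡⟨ cong (x ^ e *_) (⟦[]≔0⟧ᵐ q i M) ⟩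
  x ^ e * ⟦ q ⟧ᵐ M ∎
  where
  open ≡-Reasoning
  y = lookup M i ^ lookup q i
  z = ⟦ q [ i ]≔ 0 ⟧ᵐ M

⟦[:=]⟧ : ∀ {k} (q : Monomial k) i (M : Assignment k) →
         ⟦ q [ i := lookup M i ] ⟧ M ≡ ⟦ q ⟧ᵐ M
⟦[:=]⟧ q i M with lookup M i ^ lookup q i ℤ.≟ 0ℤ
-- The substituted polynomial is empty here, so the monomial must itself be zero: the vanishing
-- power is one of its factors.
... | yes c≡0 = begin
  0ℤ                                            ≡⟨ ℤ.*-zeroˡ (⟦ q [ i ]≔ 0 ⟧ᵐ M) ⟨
  0ℤ * ⟦ q [ i ]≔ 0 ⟧ᵐ M                        ≡⟨ cong (_* ⟦ q [ i ]≔ 0 ⟧ᵐ M) c≡0 ⟨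
  lookup M i ^ lookup q i * ⟦ q [ i ]≔ 0 ⟧ᵐ M   ≡⟨ ⟦[]≔0⟧ᵐ q i M ⟩
  ⟦ q ⟧ᵐ M                                      ∎
  where open ≡-Reasoning
... | no _    = trans (ℤ.+-identityʳ _) (⟦[]≔0⟧ᵐ q i M)

⟦weakenᵖ⟧ : ∀ {k} x (M : Assignment k) p → ⟦ weakenᵖ p ⟧ (x Vec.∷ M) ≡ ⟦ p ⟧ M
⟦weakenᵖ⟧ x M []            = refl
⟦weakenᵖ⟧ x M ((c , q) ∷ p) =
  cong₂ _+_ (cong (c *_) (ℤ.*-identityˡ _)) (⟦weakenᵖ⟧ x M p)

⟦replaceᵖ⟧ : ∀ {k} q v (M : Assignment k) → lookup M v ≡ ⟦ q ⟧ᵐ M →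
             ∀ p → ⟦ replaceᵖ q v p ⟧ M ≡ ⟦ p ⟧ M
⟦replaceᵖ⟧ q v M v≡q []             = refl
⟦replaceᵖ⟧ q v M v≡q ((c , q′) ∷ p) with Vec.≡-dec ℕ._≟_ q′ q
... | yes refl = cong₂ _+_ (cong (c *_) (trans (⟦varᵐ⟧ v M) v≡q)) (⟦replaceᵖ⟧ q v M v≡q p)
... | no _     = cong (c * ⟦ q′ ⟧ᵐ M +_) (⟦replaceᵖ⟧ q v M v≡q p)

module _ {k l} {f : Polynomial k → Polynomial l} {M : Assignment k} {M′ : Assignment l}
         (f-value : ∀ p → ⟦ f p ⟧ M′ ≡ ⟦ p ⟧ M) where

  -- Negated literals transport the comparison backwards, which is why `f` must preserve values
  -- exactly.
  ⊨-mapPolynomialsᶜ : ∀ {F} → M ⊨ F → M′ ⊨ mapPolynomialsᶜ f F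
  ⊨-mapPolynomialsᶜ = All.map⁺ ∘ All.map (Any.map⁺ ∘ Any.map λ
    { {pos (atom p c q)} h    → subst₂ (Compare c) (sym (f-value p)) (sym (f-value q)) h
    ; {neg (atom p c q)} ¬h h → ¬h (subst₂ (Compare c) (f-value p) (f-value q) h)
    })

⊨ᶠ-weaken : ∀ {m n} (F : Formula m n) {M} x → M ⊨ᶠ F → (x Vec.∷ M) ⊨ᶠ weaken F
⊨ᶠ-weaken F {M} x (cs , ss) =
  ⊨-mapPolynomialsᶜ (⟦weakenᵖ⟧ x M) cs ,
  All.map⁺ (All.map (λ {s} h V≡K → trans (h V≡K) (sym (⟦weakenᵖ⟧ x M (SplitClause.P s)))) ss)

⊨ᶠ-replace : ∀ {m n} (F : Formula m n) q v {M} → lookup M v ≡ ⟦ q ⟧ᵐ M →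
             M ⊨ᶠ F → M ⊨ᶠ replace q v F
⊨ᶠ-replace F q v {M} v≡q (cs , ss) =
  ⊨-mapPolynomialsᶜ value cs ,
  All.map⁺ (All.map (λ {s} h V≡K → trans (h V≡K) (sym (value (SplitClause.P s)))) ss)
  where value = ⟦replaceᵖ⟧ q v M v≡q

⊨ᶠ-addSplits : ∀ {m n} (F : Formula m n) {M new} → All (HoldsSplit M) new →
               M ⊨ᶠ F → M ⊨ᶠ addSplits new F
⊨ᶠ-addSplits F hs (cs , ss) = cs , All.++⁺ ss hs

HoldsEntry : ∀ {m n} → Assignment (m ℕ.+ n) → Entry m n → Set
HoldsEntry {n = n} M (entry Q V v) = lookup M (v ↑ˡ n) ≡ ⟦ Q ⟧ᵐ M

HoldsEntry-weaken : ∀ {m n} (e : Entry m n) M x → HoldsEntry M e →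
                    HoldsEntry (x Vec.∷ M) (weakenᵉ e)
HoldsEntry-weaken e M x h = trans h (sym (ℤ.*-identityˡ _))

HoldsSplit-splitClause : ∀ {m n} (e : Entry m n) M → HoldsEntry M e →
                         ∀ K → HoldsSplit M (splitClause e K)
-- Matching the premise `V = K` with `refl` makes `K` the value of `V` under `M`, the only case in
-- which the clause demands anything.
HoldsSplit-splitClause {m} (entry Q V v) M h _ refl =
  trans h (sym (⟦[:=]⟧ Q (m ↑ʳ V) M))

-- Each split clause ties its fresh variable to the monomial at a single value of `V`. The full
-- equations of the table are therefore kept in the invariant, ready for entries that are reused or
-- split further.
IntendedModel : ∀ {n} (L : State n) → Assignment (fresh L ℕ.+ n) → Set
IntendedModel L M = M ⊨ᶠ current L × All (HoldsEntry M) (table L)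

HasIntendedModel : ∀ {n} → State n → Set
HasIntendedModel L = ∃[ M ] IntendedModel L M

-- `Q` mentions only variables already present, so its value under `M` can be prepended without
-- circularity.
intended-introduce : ∀ {m n} {F : Formula m n} {T M} Q V Ks → IntendedModel (state F T) M →
                     IntendedModel (introduce F T Q V Ks) (⟦ Q ⟧ᵐ M Vec.∷ M)
intended-introduce {m} {n} {F} {M = M} Q V Ks (M⊨F , M⊨T) =
  ⊨ᶠ-addSplits (replace (0 Vec.∷ Q) zero (weaken F))
    (All.map⁺ (All.universal (HoldsSplit-splitClause e _ e-holds) Ks))
    (⊨ᶠ-replace (weaken F) (0 Vec.∷ Q) zero e-holds (⊨ᶠ-weaken F _ M⊨F)) ,
  e-holds ∷ All.map⁺ (All.map (λ {e} → HoldsEntry-weaken e M (⟦ Q ⟧ᵐ M)) M⊨T)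
  where
  e : Entry (ℕ.suc m) n
  e = entry (0 Vec.∷ Q) V zero

  e-holds : HoldsEntry (⟦ Q ⟧ᵐ M Vec.∷ M) e
  e-holds = sym (ℤ.*-identityˡ _)

module _ {n} {F₀ : CNF n} where

  intended-step : ∀ {B L L′} → Step F₀ B L L′ → HasIntendedModel L → HasIntendedModel L′
  intended-step (new {Q = Q} {V} {Ks = Ks} _ _ _ _ _ _) (M , h) =
    _ , intended-introduce Q V Ks h
  intended-step (reuse {F = F} {Q = Q} {v = v} _ _ e∈T) (M , M⊨F , M⊨T) =
    -- No variable is added, so `M` stays; the table supplies the equation that makes the
    -- replacement harmless.
    M , ⊨ᶠ-replace F Q (v ↑ˡ n) (All.lookup M⊨T e∈T) M⊨F , M⊨T

  intended-steps : ∀ {B L L′} → Star (Step F₀ B) L L′ → HasIntendedModel L → HasIntendedModel L′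
  intended-steps ε        h = h
  intended-steps (s ◅ ss) h = intended-steps ss (intended-step s h)

  intended-refine : ∀ {L B M L′ B′} → Refine F₀ L B M L′ B′ →
                    HasIntendedModel L → HasIntendedModel L′
  intended-refine {L} (refine {new = added} _ _ _ enum (steps , _)) (M , M⊨F , M⊨T) =
    intended-steps steps (M , ⊨ᶠ-addSplits (current L) (All.tabulate added-hold) M⊨F , M⊨T)
    where
    added-hold : ∀ {s} → s ∈ added → HoldsSplit M s
    -- The enumeration traces every added clause back to a table entry, whose equation holds under
    -- `M`.
    added-hold {s} s∈added with Equivalence.to (enum s) s∈added
    ... | e , K , e∈T , _ , _ , refl = HoldsSplit-splitClause e M (All.lookup M⊨T e∈T) K

module _ {c ℓ₁ ℓ₂} (C : TotalOrder c ℓ₁ ℓ₂) (0# : TotalOrder.Carrier C) (n : ℕ) where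

  open Procedure C 0# n

  module _ (cost : CostFamily) (oracle : Oracle cost) (F₀ : CNF n) where

    open Oracle oracle

    loop-sat : ∀ {L B} (run : Loop cost oracle F₀ L B sat) →
               LoopAdmissible cost oracle F₀ run → Satisfiable F₀
    loop-sat (return-sat {M} _ cost≈0) (_ , zero-cost) = restrict M , zero-cost M cost≈0
    loop-sat (iterate _ _ _ run)       (_ , adm)       = loop-sat run adm

    -- Refinement preserves the existence of an intended model up to the last oracle call, where it
    -- contradicts `unsat-correct`.
    loop-unsat : ∀ {L B} → Loop cost oracle F₀ L B unsat → ¬ HasIntendedModel L
    loop-unsat (return-unsat returns) (M , M⊨F , _) = unsat-correct returns (M , M⊨F)
    loop-unsat (iterate _ _ ref run)  h             = loop-unsat run (intended-refine ref h)

theorem3p1 : ∀ {c ℓ₁ ℓ₂} (C : TotalOrder c ℓ₁ ℓ₂) (0# : TotalOrder.Carrier C) (n : ℕ) →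
    let open Procedure C 0# n in
    (cost : CostFamily) (oracle : Oracle cost) (F₀ : CNF n) (r : Result) (run : SolveMinModels cost oracle F₀ r) →
    AdmissibleThroughout cost oracle F₀ run →
    (r ≡ sat → Satisfiable F₀) × (r ≡ unsat → ¬ Satisfiable F₀)
theorem3p1 C 0# n cost oracle F₀ r (Procedure.start B (steps , _) run) adm =
  (λ { refl → loop-sat C 0# n cost oracle F₀ run adm }) ,
  (λ { refl (M , M⊨F₀) →
    -- Initially there are no fresh variables, split clauses or table entries, so a model of `F₀` is
    -- already an intended model.
    loop-unsat C 0# n cost oracle F₀ run (intended-steps steps (M , (M⊨F₀ , []) , [])) })
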